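{- Let $\pi\colon\mathsf{States}\to\mathbb{R}_{\ge0}$ be a potential function, let $C$ be a program and let $f,g\in\mathbb{T}$. If $\mathrm{mod}(C)\cap\mathrm{Vars}(g)=\emptyset$, then $$\mathsf{aert}_\pi[\![C]\!]\big((f\oplus g)-\pi\big)\;\preceq\;\Big(\big(\mathsf{aert}_\pi[\![C]\!](f-\pi)+\pi\big)\oplus g\Big)-\pi .$$
   Context: States and programs. Fix a finite set $\mathrm{Vars}$ of variables; values are $\mathbb{N}$, locations are $\mathbb{N}_{>0}$. A stack is $s\colon \mathrm{Vars}\to\mathbb{N}$; a heap is a partial map $h$ from a finite set $\mathrm{dom}(h)\subseteq\mathbb{N}_{>0}$ to $\mathbb{N}$. $h_1\perp h_2$ means disjoint domains; then $h_1\star h_2$ is their union; $h_\emptyset$ is the empty heap. $\mathsf{States}$ is the set of pairs $(s,h)$. $s(e)$ is the value of a (heap-independent) arithmetic expression $e$ under $s$, $s\models\varphi$ means the Boolean expression $\varphi$ holds under $s$, $s[x\mapsto v]$ is the updated stack. Programs are generated by $C ::= \mathtt{tick}(e) \mid x:=e \mid x:=\mathtt{alloc}(e) \mid \langle e\rangle:=e' \mid x:=\langle e\rangle \mid \mathtt{free}(e) \mid \{C\}[p]\{C\} \mid \mathtt{if}(\varphi)\{C\}\mathtt{else}\{C\} \mid C;C \mid \mathtt{while}(\varphi)\{C\}$, where $p$ is an expression with $s(p)\in[0,1]\cap\mathbb{Q}$ for all $s$. The statements other than tick, probabilistic choice, conditional, sequencing and loops are called atomic. $\mathrm{mod}(C)$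 is the set of variables potentially modified by $C$, i.e. the variables $x$ occurring as the target of $x:=e$, $x:=\mathtt{alloc}(e)$ or $x:=\langle e\rangle$ in $C$. For a runtime $g$, $x\notin\mathrm{Vars}(g)$ means $g(s[x\mapsto v],h)=g(s,h)$ for all $(s,h)$ and $v$. Runtimes. $\mathbb{T}$ is the set of functions $\mathsf{States}\to[0,\infty]$, ordered pointwise by $\preceq$; arithmetic is pointwise with $0\cdot\infty=0$. $[\varphi]$ is the $0/1$-valued Iverson bracket. Truncated subtraction: $a\dot- b=\max(a-b,0)$, $\infty\dot- b=\infty$ for finite $b$, $a\dot-\infty=0$. Separating sum $(f\oplus g)(s,h)=\min\{f(s,h_1)+g(s,h_2)\mid h=h_1\star h_2\}$ (also applied to nonnegative functions with values in $[0,\infty]$); $(f \mathbin{ -\!\!\ominus} g)(s,h)=\sup\{g(s,h\star h')\dot- f(s,h')\mid h'\perp h\}$; $(\inf y\colon f)(s,h)=\inf_{v\in\mathbb{N}} f(s[y\mapsto v],h)$, $(\sup y\colon f)(s,h)=\sup_{v\in\mathbb{N}}f(s[y\mapsto v],h)$; $f[x/e](s,h)=f(s[x\mapsto s(e)],h)$. $\mathsf{tm}(e)(s,h)=s(e)$ if $h=h_\emptyset$, else $\infty$; $[e\mapsto e'](s,h)=0$ if $\mathrm{dom}(h)=\{s(e)\}$ and $h(s(e))=s(e')$, else $\infty$; $[e\mapsto -](s,h)=0$ if $\mathrm{dom}(h)=\{s(e)\}$, else $\infty$; $\bigoplus_{i=1}^{e} f_i$ is the separating sum over $i=1,\dots,s(e)$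 (empty one: $[\mathsf{emp}]$, which is $0$ if $h=h_\emptyset$, else $\infty$). $\mathsf{ert}[\![C]\!]\colon\mathbb{T}\to\mathbb{T}$ (with $v$ fresh): $\mathsf{ert}[\![\mathtt{tick}(e)]\!](f)=\mathsf{tm}(e)\oplus f$; $\mathsf{ert}[\![x:=e]\!](f)=f[x/e]$; $\mathsf{ert}[\![x:=\mathtt{alloc}(e)]\!](f)=\sup v\colon (\bigoplus_{i=1}^{e}[v+i-1\mapsto 0])\mathbin{ -\!\!\ominus} f[x/v]$; $\mathsf{ert}[\![\langle e\rangle:=e']\!](f)=[e\mapsto-]\oplus([e\mapsto e']\mathbin{ -\!\!\ominus} f)$; $\mathsf{ert}[\![x:=\langle e\rangle]\!](f)=\inf v\colon [e\mapsto v]\oplus([e\mapsto v]\mathbin{ -\!\!\ominus} f[x/v])$; $\mathsf{ert}[\![\mathtt{free}(e)]\!](f)=[e\mapsto-]\oplus f$; $\mathsf{ert}[\![C_1;C_2]\!](f)=\mathsf{ert}[\![C_1]\!](\mathsf{ert}[\![C_2]\!](f))$; conditional: $[\varphi]\cdot\mathsf{ert}[\![C_1]\!](f)+[\neg\varphi]\cdot\mathsf{ert}[\![C_2]\!](f)$; probabilistic choice: $p\cdot\mathsf{ert}[\![C_1]\!](f)+(1-p)\cdot\mathsf{ert}[\![C_2]\!](f)$; $\mathsf{ert}[\![\mathtt{while}(\varphi)\{C\}]\!](f)=\mathrm{lfp}\, g.\ [\neg\varphi]\cdot f+[\varphi]\cdot\mathsf{ert}[\![C]\!](g)$. Amortized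 runtimes. A potential function is $\pi\colon\mathsf{States}\to\mathbb{R}_{\ge0}$. $\mathbb{A}_\pi=\{X\colon\mathsf{States}\to\mathbb{R}\cup\{\infty\}\mid -\pi\le X\}$, ordered pointwise (complete lattice, least element $-\pi$). $\mathsf{aert}_\pi[\![C]\!]\colon\mathbb{A}_\pi\to\mathbb{A}_\pi$: $\mathsf{aert}_\pi[\![\mathtt{tick}(e)]\!](X)=e+X$; for atomic $C$ other than tick, $\mathsf{aert}_\pi[\![C]\!](X)=\mathsf{ert}[\![C]\!](X+\pi)-\pi$; sequencing by composition; conditional $[\varphi]\cdot\mathsf{aert}_\pi[\![C_1]\!](X)+[\neg\varphi]\cdot\mathsf{aert}_\pi[\![C_2]\!](X)$; probabilistic choice $p\cdot\mathsf{aert}_\pi[\![C_1]\!](X)+(1-p)\cdot\mathsf{aert}_\pi[\![C_2]\!](X)$; $\mathsf{aert}_\pi[\![\mathtt{while}(\varphi)\{C'\}]\!](X)=\mathrm{lfp}\,Y.\ [\neg\varphi]\cdot X+[\varphi]\cdot\mathsf{aert}_\pi[\![C']\!](Y)$ in $(\mathbb{A}_\pi,\preceq)$. -}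

module Defs where

open import Algebra.Bundles using (CommutativeRing)
open import Algebra.Structures using (IsCommutativeRing)
import Algebra.Construct.NaturalChoice.Max as NaturalMax
import Algebra.Definitions.RawMonoid as RawMult
import Algebra.Properties.AbelianGroup as AbelianGroupProperties
import Algebra.Properties.Ring as RingProperties
open import Axiom.ExcludedMiddle using (ExcludedMiddle)
open import Data.Bool.Base using (Bool; if_then_else_)
open import Data.Fin.Base using (Fin)
open import Data.Fin.Subset as Subset using (Subset; ⁅_⁆)
open import Data.Integer.Base as ℤ using (ℤ; +_; -[1+_])
import Data.Integer.Properties as ℤ
open import Data.Maybe.Base using (Maybe; just; nothing; _<∣>_)
open import Data.Nat.Base as ℕ using (ℕ; zero; suc; _∸_)
open import Data.Product using (∃; ∃₂; _×_; _,_; proj₁; proj₂; Σ-syntax)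
open import Data.Rational.Base as ℚ using (ℚ; 0ℚ; 1ℚ; mkℚ; ↥_; ↧ₙ_)
import Data.Rational.Properties as ℚ
open import Data.Sum.Base using (_⊎_; inj₁; inj₂)
open import Data.Vec.Base using (Vec; _[_]≔_)
open import Function.Bundles using (_⇔_)
open import Level using (0ℓ)
open import Relation.Binary.Bundles using (TotalOrder)
open import Relation.Binary.Core using (Rel)
open import Relation.Binary.PropositionalEquality using (_≡_; subst₂)
open import Relation.Binary.Structures using (IsTotalOrder)
import Relation.Binary.Construct.Add.Supremum.Equality as AddSupEq
import Relation.Binary.Construct.Add.Supremum.NonStrict as AddSup
open import Relation.Nullary.Construct.Add.Supremum using (_⁺; ⊤⁺; [_])
open import Relation.Nullary.Decidable.Core using (Dec; yes; no; does)
open import Relation.Nullary.Negation.Core using (¬_; contradiction)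

Var : ℕ → Set
Var n = Fin n

Stack : ℕ → Set
Stack n = Vec ℕ n

-- A nonempty heap as the row of its cells, up to the last allocated one
-- (`nothing` is an unallocated cell).  Since the row ends in an allocated
-- cell, every finite partial map has exactly one representation, so that
-- `_≡_` is the intended equality of heaps.
infixr 5 _∷_
data Cells : Set where
  last : ℕ → Cells
  _∷_  : Maybe ℕ → Cells → Cells

-- `nothing` is the empty heap.
Heap : Set
Heap = Maybe Cells

h∅ : Heap
h∅ = nothing

cell : Cells → ℕ → Maybe ℕ
cell (last v) zero    = just v
cell (last v) (suc i) = nothing
cell (c ∷ cs) zero    = c
cell (c ∷ cs) (suc i) = cell cs i

-- The first cell has location 1; location 0 is never allocated.
infix 9 _at_
_at_ : Heap → ℕ → Maybe ℕ
h       at zero  = nothing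
nothing at suc i = nothing
just cs at suc i = cell cs i

infix 4 _∈dom_ _⊥_
_∈dom_ : ℕ → Heap → Set
l ∈dom h = ∃ λ v → h at l ≡ just v

_⊥_ : Heap → Heap → Set
h₁ ⊥ h₂ = ∀ l → ¬ (l ∈dom h₁ × l ∈dom h₂)

_∪ᶜ_ : Cells → Cells → Cells
last v   ∪ᶜ last w   = last v
last v   ∪ᶜ (d ∷ ds) = just v ∷ ds
(c ∷ cs) ∪ᶜ last w   = (c <∣> just w) ∷ cs
(c ∷ cs) ∪ᶜ (d ∷ ds) = (c <∣> d) ∷ (cs ∪ᶜ ds)

-- Total; only used for h₁ ⊥ h₂ (otherwise h₁ takes precedence).
infixr 6 _⋆_
_⋆_ : Heap → Heap → Heap
nothing ⋆ h₂      = h₂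
just cs ⋆ nothing = just cs
just cs ⋆ just ds = just (cs ∪ᶜ ds)

State : ℕ → Set
State n = Stack n × Heap

-- Expressions are identified with their (heap-independent) semantics.

Expr : ℕ → Set
Expr n = Stack n → ℕ

BExpr : ℕ → Set
BExpr n = Stack n → Bool

record PExpr (n : ℕ) : Set where
  field
    value   : Stack n → ℚ
    value≥0 : ∀ s → 0ℚ ℚ.≤ value s
    value≤1 : ∀ s → value s ℚ.≤ 1ℚ

data Atomic (n : ℕ) : Set where
  _≔_      : Var n → Expr n → Atomic n
  _≔alloc_ : Var n → Expr n → Atomic n
  ⟨_⟩≔_    : Expr n → Expr n → Atomic n
  _≔⟨_⟩    : Var n → Expr n → Atomic n
  free     : Expr n → Atomic n

infixr 4 _⨾_
data Prog (n : ℕ) : Set where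
  tick             : Expr n → Prog n
  atomic           : Atomic n → Prog n
  _⟦_⟧_            : Prog n → PExpr n → Prog n → Prog n
  If_then_else_end : BExpr n → Prog n → Prog n → Prog n
  _⨾_              : Prog n → Prog n → Prog n
  while            : BExpr n → Prog n → Prog n

modₐ : ∀ {n} → Atomic n → Subset n
modₐ (x ≔ e)      = ⁅ x ⁆
modₐ (x ≔alloc e) = ⁅ x ⁆
modₐ (⟨ e ⟩≔ e′)  = Subset.⊥
modₐ (x ≔⟨ e ⟩)   = ⁅ x ⁆
modₐ (free e)     = Subset.⊥

mod : ∀ {n} → Prog n → Subset n
mod (tick e)                   = Subset.⊥
mod (atomic A)                 = modₐ A
mod (C₁ ⟦ p ⟧ C₂)              = mod C₁ Subset.∪ mod C₂
mod (If φ then C₁ else C₂ end) = mod C₁ Subset.∪ mod C₂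
mod (C₁ ⨾ C₂)                  = mod C₁ Subset.∪ mod C₂
mod (while φ C)                = mod C

-- The real numbers, axiomatised as a complete ordered field (unique up to
-- isomorphism).

record CompleteOrderedField : Set₁ where
  infix  8 -_ _⁻¹
  infixl 7 _*_
  infixl 6 _+_
  infix  4 _≈_ _≤_
  field
    Carrier           : Set
    _≈_ _≤_           : Rel Carrier 0ℓ
    _+_ _*_           : Carrier → Carrier → Carrier
    -_                : Carrier → Carrier
    0# 1#             : Carrier
    -- total, but specified on nonzero arguments only
    _⁻¹               : Carrier → Carrier
    isCommutativeRing : IsCommutativeRing _≈_ _+_ _*_ -_ 0# 1#
    0≉1               : ¬ (0# ≈ 1#)
    *-inverseʳ        : ∀ x → ¬ (x ≈ 0#) → x * x ⁻¹ ≈ 1#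
    isTotalOrder      : IsTotalOrder _≈_ _≤_
    +-monoˡ-≤         : ∀ z {x y} → x ≤ y → x + z ≤ y + z
    *-nonneg          : ∀ {x y} → 0# ≤ x → 0# ≤ y → 0# ≤ x * y

  IsUpperBound : (Carrier → Set) → Carrier → Set
  IsUpperBound P b = ∀ x → P x → x ≤ b

  field
    supremum : (P : Carrier → Set) → ∃ P → ∃ (IsUpperBound P) →
               ∃ λ b → IsUpperBound P b × (∀ c → IsUpperBound P c → b ≤ c)

  commutativeRing : CommutativeRing 0ℓ 0ℓ
  commutativeRing = record { isCommutativeRing = isCommutativeRing }

  totalOrder : TotalOrder 0ℓ 0ℓ 0ℓ
  totalOrder = record { isTotalOrder = isTotalOrder }

module Semantics (em : ExcludedMiddle 0ℓ) (ℝ-field : CompleteOrderedField) where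

  open CompleteOrderedField ℝ-field public
    using (_≈_; _≤_; _+_; _*_; -_; 0#; 1#; _⁻¹)
    renaming (Carrier to ℝ)
  private
    module F = CompleteOrderedField ℝ-field
    module R = CommutativeRing F.commutativeRing
    module O = TotalOrder F.totalOrder
    module AG = AbelianGroupProperties R.+-abelianGroup
    module Mult = RawMult R.+-rawMonoid
    module RP = RingProperties R.ring

  infixl 6 _-_
  _-_ : ℝ → ℝ → ℝ
  x - y = x + - y

  open NaturalMax F.totalOrder public using (_⊔_)

  fromℕ : ℕ → ℝ
  fromℕ k = k Mult.× 1#

  fromℤ : ℤ → ℝ
  fromℤ (+ k)    = fromℕ k
  fromℤ -[1+ k ] = - fromℕ (suc k)

  fromℚ : ℚ → ℝ
  fromℚ q = fromℤ (↥ q) * fromℕ (↧ₙ q) ⁻¹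

  +-mono-≤ : ∀ {x y u v} → x ≤ y → u ≤ v → x + u ≤ y + v
  +-mono-≤ {x} {y} {u} {v} x≤y u≤v =
    O.trans (F.+-monoˡ-≤ u x≤y)
      (O.trans (O.reflexive (R.+-comm y u))
        (O.trans (F.+-monoˡ-≤ y u≤v) (O.reflexive (R.+-comm v y))))

  x+y-y≈x : ∀ x y → x + y - y ≈ x
  x+y-y≈x x y = R.trans (R.+-assoc x y (- y))
    (R.trans (R.+-congˡ (R.-‿inverseʳ y)) (R.+-identityʳ x))

  x-y+y≈x : ∀ x y → x - y + y ≈ x
  x-y+y≈x x y = R.trans (R.+-assoc x (- y) y)
    (R.trans (R.+-congˡ (R.-‿inverseˡ y)) (R.+-identityʳ x))

  x≤y⇒0≤y-x : ∀ {x y} → x ≤ y → 0# ≤ y - x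
  x≤y⇒0≤y-x {x} x≤y =
    O.trans (O.reflexive (R.sym (R.-‿inverseʳ x))) (F.+-monoˡ-≤ (- x) x≤y)

  0≤y-x⇒x≤y : ∀ {x y} → 0# ≤ y - x → x ≤ y
  0≤y-x⇒x≤y {x} {y} p =
    O.trans (O.reflexive (R.sym (R.+-identityˡ x)))
      (O.trans (F.+-monoˡ-≤ x p) (O.reflexive (x-y+y≈x y x)))

  *-monoʳ-≤ : ∀ {w x y} → 0# ≤ w → x ≤ y → w * x ≤ w * y
  *-monoʳ-≤ {w} {x} {y} 0≤w x≤y = 0≤y-x⇒x≤y
    (O.trans (F.*-nonneg 0≤w (x≤y⇒0≤y-x x≤y))
      (O.reflexive (R.trans (R.distribˡ w y (- x))
        (R.+-congˡ (R.sym (RP.-‿distribʳ-* w x))))))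

  -x*-x≈x*x : ∀ x → - x * - x ≈ x * x
  -x*-x≈x*x x = R.trans (R.sym (RP.-‿distribˡ-* x (- x)))
    (R.trans (R.-‿cong (R.sym (RP.-‿distribʳ-* x x))) (AG.⁻¹-involutive (x * x)))

  x≤0⇒0≤-x : ∀ {x} → x ≤ 0# → 0# ≤ - x
  x≤0⇒0≤-x {x} p = O.trans (x≤y⇒0≤y-x p) (O.reflexive (R.+-identityˡ (- x)))

  0≤x*x : ∀ x → 0# ≤ x * x
  0≤x*x x with O.total 0# x
  ... | inj₁ p = F.*-nonneg p p
  ... | inj₂ p = O.trans (F.*-nonneg (x≤0⇒0≤-x p) (x≤0⇒0≤-x p)) (O.reflexive (-x*-x≈x*x x))

  0≤1 : 0# ≤ 1#
  0≤1 = O.trans (0≤x*x 1#) (O.reflexive (R.*-identityˡ 1#))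

  0≤fromℕ : ∀ k → 0# ≤ fromℕ k
  0≤fromℕ zero    = O.refl
  0≤fromℕ (suc k) =
    O.trans (O.reflexive (R.sym (R.+-identityˡ 0#))) (+-mono-≤ 0≤1 (0≤fromℕ k))

  fromℕ-mono : ∀ {j k} → j ℕ.≤ k → fromℕ j ≤ fromℕ k
  fromℕ-mono {k = k} ℕ.z≤n = 0≤fromℕ k
  fromℕ-mono (ℕ.s≤s p)     = +-mono-≤ O.refl (fromℕ-mono p)

  fromℕ-suc≉0 : ∀ k → ¬ (fromℕ (suc k) ≈ 0#)
  fromℕ-suc≉0 k eq = F.0≉1 (O.antisym 0≤1
    (O.trans (O.reflexive (R.sym (R.+-identityʳ 1#)))
      (O.trans (+-mono-≤ O.refl (0≤fromℕ k)) (O.reflexive eq))))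

  0≤⁻¹ : ∀ {x} → 0# ≤ x → ¬ (x ≈ 0#) → 0# ≤ x ⁻¹
  0≤⁻¹ {x} 0≤x x≉0 = O.trans (F.*-nonneg 0≤x (0≤x*x (x ⁻¹)))
    (O.reflexive (R.trans (R.sym (R.*-assoc x (x ⁻¹) (x ⁻¹)))
      (R.trans (R.*-congʳ (F.*-inverseʳ x x≉0)) (R.*-identityˡ (x ⁻¹)))))

  0≤fromℚ : ∀ {q} → 0ℚ ℚ.≤ q → 0# ≤ fromℚ q
  0≤fromℚ {mkℚ (+ k) d _}    p =
    F.*-nonneg (0≤fromℕ k) (0≤⁻¹ (0≤fromℕ (suc d)) (fromℕ-suc≉0 d))
  0≤fromℚ {mkℚ -[1+ k ] d _} p with ℚ.drop-*≤* p
  ... | ()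

  fromℚ≤1 : ∀ {q} → 0ℚ ℚ.≤ q → q ℚ.≤ 1ℚ → fromℚ q ≤ 1#
  fromℚ≤1 {mkℚ (+ k) d _}    _ p =
    O.trans (O.reflexive (R.*-comm _ _))
      (O.trans (*-monoʳ-≤ (0≤⁻¹ (0≤fromℕ (suc d)) (fromℕ-suc≉0 d)) (fromℕ-mono k≤1+d))
        (O.reflexive (R.trans (R.*-comm _ _) (F.*-inverseʳ _ (fromℕ-suc≉0 d)))))
    where
    k≤1+d : k ℕ.≤ suc d
    k≤1+d = ℤ.drop‿+≤+ (subst₂ ℤ._≤_ (ℤ.*-identityʳ (+ k)) (ℤ.*-identityˡ (+ suc d))
      (ℚ.drop-*≤* p))
  fromℚ≤1 {mkℚ -[1+ k ] d _} q _ with ℚ.drop-*≤* q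
  ... | ()

  open AddSup _≤_ public using (_≤⁺_; [_]; _≤⊤⁺)
  open AddSupEq _≈_ public using (_≈⁺_; [_]; ⊤⁺≈⊤⁺)

  ≤⁺-trans : ∀ {x y z} → x ≤⁺ y → y ≤⁺ z → x ≤⁺ z
  ≤⁺-trans = AddSup.≤⁺-trans _≤_ O.trans

  infixl 6 _+⁺_
  _+⁺_ : ℝ ⁺ → ℝ ⁺ → ℝ ⁺
  [ x ] +⁺ [ y ] = [ x + y ]
  [ x ] +⁺ ⊤⁺    = ⊤⁺
  ⊤⁺    +⁺ y     = ⊤⁺

  -- 0 · ∞ = 0; only used for nonnegative w
  infixl 7 _·_
  _·_ : ℝ → ℝ ⁺ → ℝ ⁺
  w · [ x ] = [ w * x ]
  w · ⊤⁺    = if does (em {P = w ≈ 0#}) then [ 0# ] else ⊤⁺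

  +⁺-mono-≤⁺ : ∀ {x y u v} → x ≤⁺ y → u ≤⁺ v → x +⁺ u ≤⁺ y +⁺ v
  +⁺-mono-≤⁺ [ p ]      [ q ]      = [ +-mono-≤ p q ]
  +⁺-mono-≤⁺ [ p ]      (u ≤⊤⁺)    = _ ≤⊤⁺
  +⁺-mono-≤⁺ (x ≤⊤⁺)    q          = _ ≤⊤⁺

  ·-lower : ∀ {w b x} → 0# ≤ w → [ b ] ≤⁺ x → [ w * b ] ≤⁺ w · x
  ·-lower 0≤w [ p ] = [ *-monoʳ-≤ 0≤w p ]
  ·-lower {w} {b} 0≤w (_ ≤⊤⁺) with em {P = w ≈ 0#}
  ... | yes w≈0 = [ O.reflexive (R.trans (R.*-congʳ w≈0) (R.zeroˡ b)) ]
  ... | no  _   = _ ≤⊤⁺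

  [0,∞] : Set
  [0,∞] = Σ[ x ∈ ℝ ⁺ ] [ 0# ] ≤⁺ x

  0∞ ∞ : [0,∞]
  0∞ = [ 0# ] , [ O.refl ]
  ∞  = ⊤⁺ , (_ ≤⊤⁺)

  infix 4 _≈∞_ _≤∞_
  _≈∞_ _≤∞_ : [0,∞] → [0,∞] → Set
  a ≈∞ b = proj₁ a ≈⁺ proj₁ b
  a ≤∞ b = proj₁ a ≤⁺ proj₁ b

  infixl 6 _+∞_ _∸∞_
  _+∞_ : [0,∞] → [0,∞] → [0,∞]
  (x , p) +∞ (y , q) = x +⁺ y ,
    ≤⁺-trans [ O.reflexive (R.sym (R.+-identityˡ 0#)) ] (+⁺-mono-≤⁺ p q)

  _∸∞_ : [0,∞] → [0,∞] → [0,∞]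
  a           ∸∞ (⊤⁺ , _)    = 0∞
  (⊤⁺ , _)    ∸∞ ([ y ] , _) = ∞
  ([ x ] , _) ∸∞ ([ y ] , _) = [ (x - y) ⊔ 0# ] , [ NaturalMax.x≤y⊔x F.totalOrder (x - y) 0# ]

  IsSup : ∀ {I : Set} → (I → [0,∞]) → [0,∞] → Set
  IsSup u b = (∀ i → u i ≤∞ b) × (∀ c → (∀ i → u i ≤∞ c) → b ≤∞ c)

  -- Adding numbers ≤ 0 to the family leaves its supremum in [0,∞] unchanged,
  -- and makes the set passed to `supremum` nonempty.
  supremum∞ : ∀ {I : Set} (u : I → [0,∞]) → ∃ (IsSup u)
  supremum∞ {I} u with em {P = ∃ λ r → 0# ≤ r × (∀ i → proj₁ (u i) ≤⁺ [ r ])}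
  ... | yes (r , 0≤r , bound) = ([ b ] , [ ub 0# (inj₁ O.refl) ]) , upper , least
    where
    P : ℝ → Set
    P x = (x ≤ 0#) ⊎ (∃ λ i → proj₁ (u i) ≡ [ x ])

    bounded : F.IsUpperBound P r
    bounded x (inj₁ x≤0) = O.trans x≤0 0≤r
    bounded x (inj₂ (i , eq)) with proj₁ (u i) | bound i
    bounded x (inj₂ (i , _≡_.refl)) | _ | [ p ] = p

    S = F.supremum P (0# , inj₁ O.refl) (r , bounded)
    b = proj₁ S
    ub = proj₁ (proj₂ S)

    upper : ∀ i → proj₁ (u i) ≤⁺ [ b ]
    upper i = go (proj₁ (u i)) _≡_.refl (bound i)
      where
      go : ∀ y → proj₁ (u i) ≡ y → y ≤⁺ [ r ] → y ≤⁺ [ b ]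
      go [ x ] eq _ = [ ub x (inj₂ (i , eq)) ]

    least : ∀ c → (∀ i → u i ≤∞ c) → [ b ] ≤⁺ proj₁ c
    least (⊤⁺    , _)     _ = _ ≤⊤⁺
    least ([ c ] , [ 0≤c ]) h = [ proj₂ (proj₂ S) c c-bound ]
      where
      c-bound : F.IsUpperBound P c
      c-bound x (inj₁ x≤0) = O.trans x≤0 0≤c
      c-bound x (inj₂ (i , eq)) with proj₁ (u i) | h i
      c-bound x (inj₂ (i , _≡_.refl)) | _ | [ p ] = p
  ... | no unbounded = ∞ , (λ i → _ ≤⊤⁺) , least
    where
    least : ∀ c → (∀ i → u i ≤∞ c) → ⊤⁺ ≤⁺ proj₁ c
    least (⊤⁺    , _)       _ = ⊤⁺ ≤⊤⁺
    least ([ c ] , [ 0≤c ]) h = contradiction (c , 0≤c , h) unbounded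

  ⨆ : ∀ {I : Set} → (I → [0,∞]) → [0,∞]
  ⨆ u = proj₁ (supremum∞ u)

  IsInf : ∀ {I : Set} → (I → [0,∞]) → [0,∞] → Set
  IsInf u b = (∀ i → b ≤∞ u i) × (∀ c → (∀ i → c ≤∞ u i) → c ≤∞ b)

  infimum∞ : ∀ {I : Set} (u : I → [0,∞]) → ∃ (IsInf u)
  infimum∞ u with supremum∞ {∃ λ c → ∀ i → c ≤∞ u i} proj₁
  ... | b , upper , least =
    b , (λ i → least (u i) (λ (c , c≤u) → c≤u i)) , (λ c c≤u → upper (c , c≤u))

  ⨅ : ∀ {I : Set} → (I → [0,∞]) → [0,∞]
  ⨅ u = proj₁ (infimum∞ u)

  𝕋 : ℕ → Set
  𝕋 n = State n → [0,∞]

  -- 0 where P holds, ∞ elsewhere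
  zeroOn : ∀ {n} → (State n → Set) → 𝕋 n
  zeroOn P σ = if does (em {P = P σ}) then 0∞ else ∞

  [emp] : ∀ {n} → 𝕋 n
  [emp] = zeroOn λ (s , h) → h ≡ h∅

  [_↦_] : ∀ {n} → Expr n → Expr n → 𝕋 n
  [ e ↦ e′ ] = zeroOn λ (s , h) → (∀ l → l ∈dom h ⇔ l ≡ e s) × h at e s ≡ just (e′ s)

  [_↦-] : ∀ {n} → Expr n → 𝕋 n
  [ e ↦-] = zeroOn λ (s , h) → ∀ l → l ∈dom h ⇔ l ≡ e s

  -- The minimum is over the finitely many ways of splitting h, hence an infimum.
  infixr 5 _⊕_
  _⊕_ : ∀ {n} → 𝕋 n → 𝕋 n → 𝕋 n
  (f ⊕ g) (s , h) =
    ⨅ {∃₂ λ h₁ h₂ → h₁ ⊥ h₂ × h ≡ h₁ ⋆ h₂} λ (h₁ , h₂ , _) → f (s , h₁) +∞ g (s , h₂)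

  infixr 4 _-⊖_
  _-⊖_ : ∀ {n} → 𝕋 n → 𝕋 n → 𝕋 n
  (f -⊖ g) (s , h) = ⨆ {∃ λ h′ → h′ ⊥ h} λ (h′ , _) → g (s , h ⋆ h′) ∸∞ f (s , h′)

  -- ⨁ k f = f 1 ⊕ … ⊕ f k
  ⨁ : ∀ {n} → ℕ → (ℕ → 𝕋 n) → 𝕋 n
  ⨁ zero    f = [emp]
  ⨁ (suc k) f = ⨁ k f ⊕ f (suc k)

  _[_/_] : ∀ {n} → 𝕋 n → Var n → Expr n → 𝕋 n
  (f [ x / e ]) (s , h) = f (s [ x ]≔ e s , h)

  _∉Vars_ : ∀ {n} → Var n → 𝕋 n → Set
  x ∉Vars g = ∀ s h v → g (s [ x ]≔ v , h) ≈∞ g (s , h)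

  -- ert on atomic statements, the only ones for which aert refers to it.  The
  -- fresh variable v in the rules for allocation and lookup is rendered by the
  -- value it ranges over, used as a constant expression.
  ert : ∀ {n} → Atomic n → 𝕋 n → 𝕋 n
  ert (x ≔ e)      f = f [ x / e ]
  ert (x ≔alloc e) f = λ (s , h) → ⨆ {ℕ} λ v →
    (⨁ (e s) (λ i → [ (λ _ → v ℕ.+ i ∸ 1) ↦ (λ _ → 0) ]) -⊖ f [ x / (λ _ → v) ]) (s , h)
  ert (⟨ e ⟩≔ e′)  f = [ e ↦-] ⊕ ([ e ↦ e′ ] -⊖ f)
  ert (x ≔⟨ e ⟩)   f = λ σ → ⨅ {ℕ} λ v →
    ([ e ↦ (λ _ → v) ] ⊕ ([ e ↦ (λ _ → v) ] -⊖ f [ x / (λ _ → v) ])) σ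
  ert (free e)     f = [ e ↦-] ⊕ f

  record Potential (n : ℕ) : Set where
    constructor _,_
    field
      pot   : State n → ℝ
      0≤pot : ∀ σ → 0# ≤ pot σ

  open Potential public

  record 𝔸 {n} (π : Potential n) : Set where
    constructor _,_
    field
      val    : State n → ℝ ⁺
      -π≤val : ∀ σ → [ - pot π σ ] ≤⁺ val σ

  open 𝔸 public

  -- X +π is X + π and f -π is f − π, where π is the potential indexing 𝔸.
  module _ {n} {π : Potential n} where

    infixl 6 _+π _-π
    _+π : 𝔸 π → 𝕋 n
    ((X , -π≤X) +π) σ = X σ +⁺ [ pot π σ ] ,
      ≤⁺-trans [ O.reflexive (R.sym (R.-‿inverseˡ (pot π σ))) ]
               (+⁺-mono-≤⁺ (-π≤X σ) [ O.refl ])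

    _-π : 𝕋 n → 𝔸 π
    f -π = (λ σ → proj₁ (f σ) +⁺ [ - pot π σ ]) , λ σ →
      ≤⁺-trans [ O.reflexive (R.sym (R.+-identityˡ (- pot π σ))) ]
               (+⁺-mono-≤⁺ (proj₂ (f σ)) [ O.refl ])

    infix 4 _⪯_ _≗_
    _⪯_ _≗_ : 𝔸 π → 𝔸 π → Set
    X ⪯ Y = ∀ σ → val X σ ≤⁺ val Y σ
    X ≗ Y = ∀ σ → val X σ ≈⁺ val Y σ

    IsLeastFixpoint : (𝔸 π → 𝔸 π) → 𝔸 π → Set
    IsLeastFixpoint F Y = F Y ≗ Y × (∀ Z → F Z ≗ Z → Y ⪯ Z)

    -- The least fixed point.  (aert is monotone, so for the operators of loops
    -- it exists by the Knaster–Tarski theorem; the second clause of `select`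
    -- is a junk value for operators without a least fixed point.)
    lfp : (𝔸 π → 𝔸 π) → 𝔸 π
    lfp F = select em
      where
      select : Dec (∃ (IsLeastFixpoint F)) → 𝔸 π
      select (yes (Y , _)) = Y
      select (no _)        = (λ _ → ⊤⁺) , (λ _ → _ ≤⊤⁺)

    infixr 6 _⊞_
    _⊞_ : Expr n → 𝔸 π → 𝔸 π
    e ⊞ (X , -π≤X) = (λ (s , h) → [ fromℕ (e s) ] +⁺ X (s , h)) , λ (s , h) →
      ≤⁺-trans [ O.reflexive (R.sym (R.+-identityˡ (- pot π (s , h)))) ]
               (+⁺-mono-≤⁺ [ 0≤fromℕ (e s) ] (-π≤X (s , h)))

    -- [φ]·X + [¬φ]·Y (recall 0 · ∞ = 0)
    cond : BExpr n → 𝔸 π → 𝔸 π → 𝔸 π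
    cond φ (X , -π≤X) (Y , -π≤Y) =
      (λ (s , h) → if φ s then X (s , h) else Y (s , h)) , lower
      where
      lower : ∀ σ → [ - pot π σ ] ≤⁺ (if φ (proj₁ σ) then X σ else Y σ)
      lower σ@(s , h) with φ s
      ... | Bool.true  = -π≤X σ
      ... | Bool.false = -π≤Y σ

    -- p·X + (1−p)·Y
    choice : PExpr n → 𝔸 π → 𝔸 π → 𝔸 π
    choice p (X , -π≤X) (Y , -π≤Y) =
      (λ (s , h) → w s · X (s , h) +⁺ (1# - w s) · Y (s , h)) , λ (s , h) →
        ≤⁺-trans [ O.reflexive (split (w s) (- pot π (s , h))) ]
          (+⁺-mono-≤⁺ (·-lower (0≤fromℚ (value≥0 s)) (-π≤X (s , h)))
                      (·-lower (x≤y⇒0≤y-x (fromℚ≤1 (value≥0 s) (value≤1 s))) (-π≤Y (s , h))))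
      where
      open PExpr p
      w : Stack n → ℝ
      w s = fromℚ (value s)

      split : ∀ a x → x ≈ a * x + (1# - a) * x
      split a x = R.trans (R.sym (R.*-identityˡ x))
        (R.trans (R.*-congʳ (R.trans (R.sym (x-y+y≈x 1# a)) (R.+-comm _ a)))
          (R.distribʳ x a (1# - a)))

  aert : ∀ {n} (π : Potential n) → Prog n → 𝔸 π → 𝔸 π
  aert π (tick e)                   X = e ⊞ X
  aert π (atomic A)                 X = ert A (X +π) -π
  aert π (C₁ ⟦ p ⟧ C₂)              X = choice p (aert π C₁ X) (aert π C₂ X)
  aert π (If φ then C₁ else C₂ end) X = cond φ (aert π C₁ X) (aert π C₂ X)
  aert π (C₁ ⨾ C₂)                  X = aert π C₁ (aert π C₂ X)
  aert π (while φ C)                X = lfp λ Y → cond φ (aert π C Y) X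

{-# OPTIONS --safe #-}

-- For an amortized runtime X put X ⊛ g = ((X + π) ⊕ g) − π.  Framing with g is
-- monotone and every program construct commutes with it up to ⪯, so
-- aert C (X ⊛ g) ⪯ aert C X ⊛ g follows by induction on C; for a loop with least
-- fixed point L, the framed L ⊛ g is a prefixed point of the framed loop operator.
-- Infima are moved past +∞ by residuation: a ∸ c ≤ b iff a ≤ b + c.
module Submission where

open import Defs
open import Axiom.ExcludedMiddle using (ExcludedMiddle)
open import Data.Nat.Base using (ℕ)
open import Data.Fin.Subset using (_∈_)
open import Level using (0ℓ)

open import Algebra.Bundles using (CommutativeRing; CommutativeSemigroup)
import Algebra.Construct.NaturalChoice.Max as NaturalMax
import Algebra.Properties.CommutativeSemigroup as CommutativeSemigroupProperties
open import Data.Bool.Base using (true; false; if_then_else_)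
open import Data.Fin.Subset.Properties using (p⊆p∪q; q⊆p∪q; x∈⁅x⁆)
open import Data.Maybe.Base using (just; nothing; _<∣>_)
open import Data.Maybe.Properties using (<∣>-assoc)
open import Data.Nat.Base as ℕ using (zero; suc; _∸_)
open import Data.Product using (∃; ∃₂; _×_; _,_; proj₁; proj₂)
open import Data.Sum.Base using (_⊎_; inj₁; inj₂)
open import Data.Vec.Base using (_[_]≔_)
open import Relation.Binary.Bundles using (Poset; TotalOrder)
import Relation.Binary.Construct.Add.Supremum.NonStrict as AddSup
open import Relation.Binary.PropositionalEquality
  using (_≡_; refl; sym; trans; cong; cong₂; module ≡-Reasoning)
import Relation.Binary.Reasoning.PartialOrder as PartialOrderReasoning
open import Relation.Nullary.Construct.Add.Supremum using (_⁺; ⊤⁺; [_])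
open import Relation.Nullary.Decidable.Core using (yes; no)
open import Relation.Nullary.Negation.Core using (contradiction)

-- Heaps

cell-∪ᶜ : ∀ cs ds i → cell (cs ∪ᶜ ds) i ≡ (cell cs i <∣> cell ds i)
cell-∪ᶜ (last v) (last w) zero    = refl
cell-∪ᶜ (last v) (last w) (suc i) = refl
cell-∪ᶜ (last v) (d ∷ ds) zero    = refl
cell-∪ᶜ (last v) (d ∷ ds) (suc i) = refl
cell-∪ᶜ (c ∷ cs) (last w) zero    = refl
cell-∪ᶜ (c ∷ cs) (last w) (suc i) with cell cs i
... | just _  = refl
... | nothing = refl
cell-∪ᶜ (c ∷ cs) (d ∷ ds) zero    = refl
cell-∪ᶜ (c ∷ cs) (d ∷ ds) (suc i) = cell-∪ᶜ cs ds i

-- Cell by cell the union is left-biased choice, which is associative.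
∪ᶜ-assoc : ∀ bs cs ds → (bs ∪ᶜ cs) ∪ᶜ ds ≡ bs ∪ᶜ (cs ∪ᶜ ds)
∪ᶜ-assoc (last u) (last v) (last w) = refl
∪ᶜ-assoc (last u) (last v) (d ∷ ds) = refl
∪ᶜ-assoc (last u) (c ∷ cs) (last w) = refl
∪ᶜ-assoc (last u) (c ∷ cs) (d ∷ ds) = refl
∪ᶜ-assoc (b ∷ bs) (last v) (last w) = cong (_∷ bs) (<∣>-assoc b (just v) (just w))
∪ᶜ-assoc (b ∷ bs) (last v) (d ∷ ds) = cong (_∷ (bs ∪ᶜ ds)) (<∣>-assoc b (just v) d)
∪ᶜ-assoc (b ∷ bs) (c ∷ cs) (last w) = cong (_∷ (bs ∪ᶜ cs)) (<∣>-assoc b c (just w))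
∪ᶜ-assoc (b ∷ bs) (c ∷ cs) (d ∷ ds) = cong₂ _∷_ (<∣>-assoc b c d) (∪ᶜ-assoc bs cs ds)

⊥-tail : ∀ {c d cs ds} → just (c ∷ cs) ⊥ just (d ∷ ds) → just cs ⊥ just ds
-- Location 0 is never allocated. Location `suc l` of the tails is location `suc (suc l)` of the
-- full rows.
⊥-tail dis zero    ((_ , ()) , _)
⊥-tail dis (suc l) p = dis (suc (suc l)) p

-- The union prefers its left argument, so the order matters only where both cells are allocated.
-- Two allocated first cells would share location 1, and `⊥-tail` passes disjointness on to the
-- remaining cells.
∪ᶜ-comm : ∀ cs ds → just cs ⊥ just ds → cs ∪ᶜ ds ≡ ds ∪ᶜ cs
∪ᶜ-comm (last v)       (last w)       dis = contradiction ((v , refl) , (w , refl)) (dis 1)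
∪ᶜ-comm (last v)       (just w ∷ ds)  dis = contradiction ((v , refl) , (w , refl)) (dis 1)
∪ᶜ-comm (last v)       (nothing ∷ ds) dis = refl
∪ᶜ-comm (just v ∷ cs)  (last w)       dis = contradiction ((v , refl) , (w , refl)) (dis 1)
∪ᶜ-comm (nothing ∷ cs) (last w)       dis = refl
∪ᶜ-comm (just v ∷ cs)  (just w ∷ ds)  dis = contradiction ((v , refl) , (w , refl)) (dis 1)
∪ᶜ-comm (just v ∷ cs)  (nothing ∷ ds) dis = cong (just v ∷_) (∪ᶜ-comm cs ds (⊥-tail dis))
∪ᶜ-comm (nothing ∷ cs) (just w ∷ ds)  dis = cong (just w ∷_) (∪ᶜ-comm cs ds (⊥-tail dis))
∪ᶜ-comm (nothing ∷ cs) (nothing ∷ ds) dis = cong (nothing ∷_) (∪ᶜ-comm cs ds (⊥-tail dis))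

-- Reduces the facts about domains below to reasoning about `_<∣>_` at a single location.
⋆-at : ∀ h₁ h₂ l → (h₁ ⋆ h₂) at l ≡ (h₁ at l <∣> h₂ at l)
⋆-at nothing   h₂        zero    = refl
⋆-at nothing   h₂        (suc i) = refl
⋆-at (just cs) nothing   zero    = refl
⋆-at (just cs) nothing   (suc i) with cell cs i
... | just _  = refl
... | nothing = refl
⋆-at (just cs) (just ds) zero    = refl
⋆-at (just cs) (just ds) (suc i) = cell-∪ᶜ cs ds i

⋆-assoc : ∀ h₁ h₂ h₃ → (h₁ ⋆ h₂) ⋆ h₃ ≡ h₁ ⋆ (h₂ ⋆ h₃)
⋆-assoc nothing   h₂        h₃        = refl
⋆-assoc (just bs) nothing   h₃        = refl
⋆-assoc (just bs) (just cs) nothing   = refl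
⋆-assoc (just bs) (just cs) (just ds) = cong just (∪ᶜ-assoc bs cs ds)

⋆-comm : ∀ h₁ h₂ → h₁ ⊥ h₂ → h₁ ⋆ h₂ ≡ h₂ ⋆ h₁
⋆-comm nothing   nothing   _   = refl
⋆-comm nothing   (just ds) _   = refl
⋆-comm (just cs) nothing   _   = refl
⋆-comm (just cs) (just ds) dis = cong just (∪ᶜ-comm cs ds dis)

∈dom-⋆⁻ : ∀ h₁ h₂ l → l ∈dom (h₁ ⋆ h₂) → l ∈dom h₁ ⊎ l ∈dom h₂
∈dom-⋆⁻ h₁ h₂ l (v , eq) with h₁ at l in eq₁ | trans (sym (⋆-at h₁ h₂ l)) eq
... | just u  | _   = inj₁ (u , refl)
... | nothing | eq₂ = inj₂ (v , eq₂)

∈dom-⋆⁺ˡ : ∀ h₁ h₂ l → l ∈dom h₁ → l ∈dom (h₁ ⋆ h₂)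
∈dom-⋆⁺ˡ h₁ h₂ l (v , eq) = v , trans (⋆-at h₁ h₂ l) (cong (_<∣> h₂ at l) eq)

∈dom-⋆⁺ʳ : ∀ h₁ h₂ l → l ∈dom h₂ → l ∈dom (h₁ ⋆ h₂)
∈dom-⋆⁺ʳ h₁ h₂ l (v , eq) with h₁ at l | ⋆-at h₁ h₂ l
... | just u  | eq₁ = u , eq₁
... | nothing | eq₁ = v , trans eq₁ eq

⊥-sym : ∀ {h₁ h₂} → h₁ ⊥ h₂ → h₂ ⊥ h₁
⊥-sym dis l (p , q) = dis l (q , p)

⊥-⋆⁻ˡ : ∀ h₁ h₂ {h} → h ⊥ (h₁ ⋆ h₂) → h ⊥ h₁
⊥-⋆⁻ˡ h₁ h₂ dis l (p , q) = dis l (p , ∈dom-⋆⁺ˡ h₁ h₂ l q)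

⊥-⋆⁻ʳ : ∀ h₁ h₂ {h} → h ⊥ (h₁ ⋆ h₂) → h ⊥ h₂
⊥-⋆⁻ʳ h₁ h₂ dis l (p , q) = dis l (p , ∈dom-⋆⁺ʳ h₁ h₂ l q)

⊥-⋆⁺ : ∀ h₁ h₂ {h} → h ⊥ h₁ → h ⊥ h₂ → h ⊥ (h₁ ⋆ h₂)
⊥-⋆⁺ h₁ h₂ dis₁ dis₂ l (p , q) with ∈dom-⋆⁻ h₁ h₂ l q
... | inj₁ q₁ = dis₁ l (p , q₁)
... | inj₂ q₂ = dis₂ l (p , q₂)

-- Used in `-⊖-frame` to bring the heap demanded by `_-⊖_` next to the part of the heap that does
-- not belong to the frame.
⋆-swap : ∀ h₁ h₂ h₃ → h₂ ⊥ h₃ → (h₁ ⋆ h₂) ⋆ h₃ ≡ (h₁ ⋆ h₃) ⋆ h₂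
⋆-swap h₁ h₂ h₃ dis = begin
  (h₁ ⋆ h₂) ⋆ h₃ ≡⟨ ⋆-assoc h₁ h₂ h₃ ⟩
  h₁ ⋆ (h₂ ⋆ h₃) ≡⟨ cong (h₁ ⋆_) (⋆-comm h₂ h₃ dis) ⟩
  h₁ ⋆ (h₃ ⋆ h₂) ≡⟨ ⋆-assoc h₁ h₃ h₂ ⟨
  (h₁ ⋆ h₃) ⋆ h₂ ∎
  where open ≡-Reasoning

module Framing (em : ExcludedMiddle 0ℓ) (ℝ-field : CompleteOrderedField) where

  open Semantics em ℝ-field

  private
    module F = CompleteOrderedField ℝ-field
    module R = CommutativeRing F.commutativeRing
    module O = TotalOrder F.totalOrder
    module Max = NaturalMax F.totalOrder

  -- Extended reals

  ≤⁺-poset : Poset 0ℓ 0ℓ 0ℓ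
  ≤⁺-poset = record { isPartialOrder = AddSup.≤⁺-isPartialOrder _≤_ O.isPartialOrder }

  module P = Poset ≤⁺-poset
  open PartialOrderReasoning ≤⁺-poset

  +⁺-cong : ∀ {x y u v} → x ≈⁺ y → u ≈⁺ v → x +⁺ u ≈⁺ y +⁺ v
  +⁺-cong [ p ]  [ q ]  = [ R.+-cong p q ]
  +⁺-cong [ p ]  ⊤⁺≈⊤⁺  = ⊤⁺≈⊤⁺
  +⁺-cong ⊤⁺≈⊤⁺  q      = ⊤⁺≈⊤⁺

  +⁺-assoc : ∀ x y z → (x +⁺ y) +⁺ z ≈⁺ x +⁺ (y +⁺ z)
  +⁺-assoc [ x ] [ y ] [ z ] = [ R.+-assoc x y z ]
  +⁺-assoc [ x ] [ y ] ⊤⁺    = ⊤⁺≈⊤⁺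
  +⁺-assoc [ x ] ⊤⁺    z     = ⊤⁺≈⊤⁺
  +⁺-assoc ⊤⁺    y     z     = ⊤⁺≈⊤⁺

  +⁺-comm : ∀ x y → x +⁺ y ≈⁺ y +⁺ x
  +⁺-comm [ x ] [ y ] = [ R.+-comm x y ]
  +⁺-comm [ x ] ⊤⁺    = ⊤⁺≈⊤⁺
  +⁺-comm ⊤⁺    [ y ] = ⊤⁺≈⊤⁺
  +⁺-comm ⊤⁺    ⊤⁺    = ⊤⁺≈⊤⁺

  +⁺-commutativeSemigroup : CommutativeSemigroup 0ℓ 0ℓ
  +⁺-commutativeSemigroup = record
    { _∙_ = _+⁺_
    ; isCommutativeSemigroup = record
      { isSemigroup = record
        { isMagma = record { isEquivalence = P.isEquivalence ; ∙-cong = +⁺-cong }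
        ; assoc   = +⁺-assoc
        }
      ; comm = +⁺-comm
      }
    }

  open CommutativeSemigroupProperties +⁺-commutativeSemigroup
    using (interchange; xy∙z≈xz∙y)

  +⁺-monoˡ : ∀ z {x y} → x ≤⁺ y → x +⁺ z ≤⁺ y +⁺ z
  +⁺-monoˡ z p = +⁺-mono-≤⁺ p (P.refl {z})

  +⁺-monoʳ : ∀ z {x y} → x ≤⁺ y → z +⁺ x ≤⁺ z +⁺ y
  +⁺-monoʳ z p = +⁺-mono-≤⁺ (P.refl {z}) p

  x≤y+⊤ : ∀ {x} y → x ≤⁺ y +⁺ ⊤⁺
  x≤y+⊤ [ y ] = _ ≤⊤⁺
  x≤y+⊤ ⊤⁺    = _ ≤⊤⁺

  -- Potentials are finite, so they cancel even when `x` is infinite. This is what lets them be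
  -- moved across inequalities.
  -p+p : ∀ x p → x +⁺ [ - p ] +⁺ [ p ] ≈⁺ x
  -p+p [ x ] p = [ x-y+y≈x x p ]
  -p+p ⊤⁺    p = ⊤⁺≈⊤⁺

  +p-p : ∀ x p → x +⁺ [ p ] +⁺ [ - p ] ≈⁺ x
  +p-p [ x ] p = [ x+y-y≈x x p ]
  +p-p ⊤⁺    p = ⊤⁺≈⊤⁺

  x≤y-p⇒x+p≤y : ∀ {x y} p → x ≤⁺ y +⁺ [ - p ] → x +⁺ [ p ] ≤⁺ y
  x≤y-p⇒x+p≤y {y = y} p q = P.trans (+⁺-monoˡ [ p ] q) (P.reflexive (-p+p y p))

  x+p≤y⇒x≤y-p : ∀ {x y} p → x +⁺ [ p ] ≤⁺ y → x ≤⁺ y +⁺ [ - p ]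
  x+p≤y⇒x≤y-p {x} p q = P.trans (P.reflexive (P.Eq.sym (+p-p x p))) (+⁺-monoˡ [ - p ] q)

  -- Truncation at 0, and the value 0 when ∞ is subtracted, do no harm because `b` is nonnegative.
  ∸-residual⁺ : ∀ (a b c : [0,∞]) → a ≤∞ b +∞ c → a ∸∞ c ≤∞ b
  ∸-residual⁺ a           (b , 0≤b)         (⊤⁺ , _)    p     = 0≤b
  ∸-residual⁺ (⊤⁺ , _)    (⊤⁺ , _)          ([ c ] , _) p     = _ ≤⊤⁺
  ∸-residual⁺ ([ a ] , _) (⊤⁺ , _)          ([ c ] , _) p     = _ ≤⊤⁺
  ∸-residual⁺ ([ a ] , _) ([ b ] , [ 0≤b ]) ([ c ] , _) [ p ] = [ Max.⊔-lub
    (O.trans (+-mono-≤ p O.refl) (O.reflexive (x+y-y≈x b c))) 0≤b ]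

  -- If `c` is infinite, so is the right-hand side. Otherwise the untruncated difference lies below
  -- the truncated one.
  ∸-residual⁻ : ∀ (a b c : [0,∞]) → a ∸∞ c ≤∞ b → a ≤∞ b +∞ c
  ∸-residual⁻ a           (b , _)     (⊤⁺ , _)    p       = x≤y+⊤ b
  ∸-residual⁻ (⊤⁺ , _)    (⊤⁺ , _)    ([ c ] , _) p       = _ ≤⊤⁺
  ∸-residual⁻ ([ a ] , _) (⊤⁺ , _)    ([ c ] , _) p       = _ ≤⊤⁺
  ∸-residual⁻ ([ a ] , _) ([ b ] , _) ([ c ] , _) [ p ]   =
    [ O.trans (O.reflexive (R.sym (x-y+y≈x a c)))
        (+-mono-≤ (O.trans (Max.x≤x⊔y (a - c) 0#) p) O.refl) ]

  ·-mono : ∀ {w} → 0# ≤ w → ∀ {x y} → x ≤⁺ y → w · x ≤⁺ w · y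
  ·-mono     0≤w [ p ]           = [ *-monoʳ-≤ 0≤w p ]
  ·-mono {w} 0≤w {⊤⁺}    (_ ≤⊤⁺) = P.refl {w · ⊤⁺}
  -- For zero `w` the right-hand side is 0 instead of ∞; `·-lower` makes this distinction.
  ·-mono {w} 0≤w {[ x ]} (_ ≤⊤⁺) = ·-lower 0≤w (_ ≤⊤⁺)

  ·-distribˡ : ∀ w x c → w · (x +⁺ [ c ]) ≈⁺ w · x +⁺ [ w * c ]
  ·-distribˡ w [ x ] c = [ R.distribˡ w x c ]
  ·-distribˡ w ⊤⁺    c with em {P = w ≈ 0#}
  -- By the convention 0 · ∞ = 0 both products with ∞ are 0 here, and `w * c` vanishes as well.
  ... | yes w≈0 = [ R.sym (R.trans (R.+-identityˡ _) (R.trans (R.*-congʳ w≈0) (R.zeroˡ c))) ]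
  ... | no  _   = ⊤⁺≈⊤⁺

  -- The weights add up to 1, so a common finite summand passes through the mixture unchanged. In
  -- `choice-frame` the summand is a potential or the cost of the frame.
  mix-shift : ∀ w x y c →
    w · (x +⁺ [ c ]) +⁺ (1# - w) · (y +⁺ [ c ]) ≈⁺ (w · x +⁺ (1# - w) · y) +⁺ [ c ]
  mix-shift w x y c = begin-equality
    w · (x +⁺ [ c ]) +⁺ w′ · (y +⁺ [ c ])
      ≈⟨ +⁺-cong (·-distribˡ w x c) (·-distribˡ w′ y c) ⟩
    (w · x +⁺ [ w * c ]) +⁺ (w′ · y +⁺ [ w′ * c ])
      ≈⟨ interchange (w · x) [ w * c ] (w′ · y) [ w′ * c ] ⟩
    (w · x +⁺ w′ · y) +⁺ [ w * c + w′ * c ]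
      ≈⟨ +⁺-cong (P.Eq.refl {w · x +⁺ w′ · y}) [ weights ] ⟩
    (w · x +⁺ w′ · y) +⁺ [ c ] ∎
    where
    w′ = 1# - w

    weights : w * c + w′ * c ≈ c
    weights = R.trans (R.sym (R.distribʳ c w w′))
      (R.trans (R.*-congʳ (R.trans (R.+-comm w w′) (x-y+y≈x 1# w))) (R.*-identityˡ c))

  -- Suprema and infima

  ⨅-lower : ∀ {I : Set} (u : I → [0,∞]) i → ⨅ u ≤∞ u i
  ⨅-lower u = proj₁ (proj₂ (infimum∞ u))

  ⨅-greatest : ∀ {I : Set} (u : I → [0,∞]) c → (∀ i → c ≤∞ u i) → c ≤∞ ⨅ u
  ⨅-greatest u = proj₂ (proj₂ (infimum∞ u))

  ⨆-upper : ∀ {I : Set} (u : I → [0,∞]) i → u i ≤∞ ⨆ u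
  ⨆-upper u = proj₁ (proj₂ (supremum∞ u))

  ⨆-least : ∀ {I : Set} (u : I → [0,∞]) c → (∀ i → u i ≤∞ c) → ⨆ u ≤∞ c
  ⨆-least u = proj₂ (proj₂ (supremum∞ u))

  -- `_+∞ c` is right adjoint to `_∸∞ c` and therefore preserves infima.
  ⨅-+-greatest : ∀ {I : Set} (u : I → [0,∞]) c d → (∀ i → d ≤∞ u i +∞ c) → d ≤∞ ⨅ u +∞ c
  ⨅-+-greatest u c d p = ∸-residual⁻ d (⨅ u) c
    (⨅-greatest u (d ∸∞ c) λ i → ∸-residual⁺ d (u i) c (p i))

  -- Runtimes

  infix 3 _⊑_
  _⊑_ : ∀ {n} → 𝕋 n → 𝕋 n → Set
  f ⊑ g = ∀ σ → f σ ≤∞ g σ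

  ⊑-refl : ∀ {n} (f : 𝕋 n) → f ⊑ f
  ⊑-refl f σ = P.refl {proj₁ (f σ)}

  module _ {n : ℕ} (f g : 𝕋 n) where

    -- Together with `⊕-greatest` this is the universal property of `_⊕_`, phrased for heaps already
    -- in the form `h₁ ⋆ h₂` so that no splitting equation has to be carried along.
    ⊕-lower : ∀ s h₁ h₂ → h₁ ⊥ h₂ → (f ⊕ g) (s , h₁ ⋆ h₂) ≤∞ f (s , h₁) +∞ g (s , h₂)
    ⊕-lower s h₁ h₂ dis = ⨅-lower
      {∃₂ λ k₁ k₂ → k₁ ⊥ k₂ × h₁ ⋆ h₂ ≡ k₁ ⋆ k₂}
      (λ (k₁ , k₂ , _) → f (s , k₁) +∞ g (s , k₂)) (h₁ , h₂ , dis , refl)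

    ⊕-greatest : ∀ (k : 𝕋 n) →
      (∀ s h₁ h₂ → h₁ ⊥ h₂ → k (s , h₁ ⋆ h₂) ≤∞ f (s , h₁) +∞ g (s , h₂)) → k ⊑ f ⊕ g
    ⊕-greatest k p (s , h) = ⨅-greatest
      {∃₂ λ k₁ k₂ → k₁ ⊥ k₂ × h ≡ k₁ ⋆ k₂}
      (λ (k₁ , k₂ , _) → f (s , k₁) +∞ g (s , k₂)) (k (s , h))
      λ { (h₁ , h₂ , dis , refl) → p s h₁ h₂ dis }

    -- A quantitative modus ponens. With `-⊖-least` it makes `f -⊖_` left adjoint to `_⊕ f`.
    -⊖-upper : ∀ s h h′ → h′ ⊥ h → g (s , h ⋆ h′) ≤∞ (f -⊖ g) (s , h) +∞ f (s , h′)
    -⊖-upper s h h′ dis = ∸-residual⁻ (g (s , h ⋆ h′)) ((f -⊖ g) (s , h)) (f (s , h′))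
      (⨆-upper {∃ λ k → k ⊥ h} (λ (k , _) → g (s , h ⋆ k) ∸∞ f (s , k)) (h′ , dis))

    -⊖-least : ∀ (k : 𝕋 n) →
      (∀ s h h′ → h′ ⊥ h → g (s , h ⋆ h′) ≤∞ k (s , h) +∞ f (s , h′)) → f -⊖ g ⊑ k
    -⊖-least k p (s , h) = ⨆-least {∃ λ k → k ⊥ h}
      (λ (k , _) → g (s , h ⋆ k) ∸∞ f (s , k)) (k (s , h))
      λ (h′ , dis) → ∸-residual⁺ (g (s , h ⋆ h′)) (k (s , h)) (f (s , h′)) (p s h h′ dis)

  ⊕-mono : ∀ {n} (f f′ g g′ : 𝕋 n) → f ⊑ f′ → g ⊑ g′ → f ⊕ g ⊑ f′ ⊕ g′
  ⊕-mono f f′ g g′ p q = ⊕-greatest f′ g′ (f ⊕ g) λ s h₁ h₂ dis →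
    P.trans (⊕-lower f g s h₁ h₂ dis) (+⁺-mono-≤⁺ (p (s , h₁)) (q (s , h₂)))

  -⊖-monoʳ : ∀ {n} (f g g′ : 𝕋 n) → g ⊑ g′ → f -⊖ g ⊑ f -⊖ g′
  -⊖-monoʳ f g g′ p = -⊖-least f g (f -⊖ g′) λ s h h′ dis →
    P.trans (p (s , h ⋆ h′)) (-⊖-upper f g′ s h h′ dis)

  ⊕-assoc-⊑ : ∀ {n} (f g k : 𝕋 n) → f ⊕ (g ⊕ k) ⊑ (f ⊕ g) ⊕ k
  ⊕-assoc-⊑ f g k = ⊕-greatest (f ⊕ g) k (f ⊕ (g ⊕ k)) λ s h h₃ dis →
    -- The infimum defining `f ⊕ g` stands below an addition on the larger side; residuation allows
    -- an arbitrary splitting of `h` to be fixed.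
    ⨅-+-greatest {∃₂ λ k₁ k₂ → k₁ ⊥ k₂ × h ≡ k₁ ⋆ k₂}
      (λ (k₁ , k₂ , _) → f (s , k₁) +∞ g (s , k₂))
      (k (s , h₃)) ((f ⊕ (g ⊕ k)) (s , h ⋆ h₃))
      λ { (h₁ , h₂ , dis₁₂ , refl) → begin
        proj₁ ((f ⊕ (g ⊕ k)) (s , (h₁ ⋆ h₂) ⋆ h₃))
          ≡⟨ cong (λ h → proj₁ ((f ⊕ (g ⊕ k)) (s , h))) (⋆-assoc h₁ h₂ h₃) ⟩
        proj₁ ((f ⊕ (g ⊕ k)) (s , h₁ ⋆ (h₂ ⋆ h₃)))
          ≤⟨ ⊕-lower f (g ⊕ k) s h₁ (h₂ ⋆ h₃)
               (⊥-⋆⁺ h₂ h₃ dis₁₂ (⊥-sym (⊥-⋆⁻ˡ h₁ h₂ (⊥-sym dis)))) ⟩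
        proj₁ (f (s , h₁)) +⁺ proj₁ ((g ⊕ k) (s , h₂ ⋆ h₃))
          ≤⟨ +⁺-monoʳ (proj₁ (f (s , h₁)))
               (⊕-lower g k s h₂ h₃ (⊥-sym (⊥-⋆⁻ʳ h₁ h₂ (⊥-sym dis)))) ⟩
        proj₁ (f (s , h₁)) +⁺ (proj₁ (g (s , h₂)) +⁺ proj₁ (k (s , h₃)))
          ≈⟨ +⁺-assoc (proj₁ (f (s , h₁))) (proj₁ (g (s , h₂))) (proj₁ (k (s , h₃))) ⟨
        proj₁ (f (s , h₁)) +⁺ proj₁ (g (s , h₂)) +⁺ proj₁ (k (s , h₃)) ∎ }

  -- The added heap `h′` is disjoint from both parts of `h₁ ⋆ h₂`, so it can be joined to `h₁` while
  -- `h₂` still pays for the frame `k`.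
  -⊖-frame : ∀ {n} (f g k : 𝕋 n) → f -⊖ (g ⊕ k) ⊑ (f -⊖ g) ⊕ k
  -⊖-frame f g k = ⊕-greatest (f -⊖ g) k (f -⊖ (g ⊕ k)) λ s h₁ h₂ dis →
    ⨆-least {∃ λ h′ → h′ ⊥ (h₁ ⋆ h₂)}
      (λ (h′ , _) → (g ⊕ k) (s , (h₁ ⋆ h₂) ⋆ h′) ∸∞ f (s , h′))
      ((f -⊖ g) (s , h₁) +∞ k (s , h₂)) λ (h′ , dis′) →
      ∸-residual⁺ ((g ⊕ k) (s , (h₁ ⋆ h₂) ⋆ h′))
        ((f -⊖ g) (s , h₁) +∞ k (s , h₂)) (f (s , h′))
        (let dis₁ = ⊥-⋆⁻ˡ h₁ h₂ dis′
             dis₂ = ⊥-⋆⁻ʳ h₁ h₂ dis′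
         in begin
        proj₁ ((g ⊕ k) (s , (h₁ ⋆ h₂) ⋆ h′))
          ≡⟨ cong (λ h → proj₁ ((g ⊕ k) (s , h))) (⋆-swap h₁ h₂ h′ (⊥-sym dis₂)) ⟩
        proj₁ ((g ⊕ k) (s , (h₁ ⋆ h′) ⋆ h₂))
          ≤⟨ ⊕-lower g k s (h₁ ⋆ h′) h₂ (⊥-sym (⊥-⋆⁺ h₁ h′ (⊥-sym dis) (⊥-sym dis₂))) ⟩
        proj₁ (g (s , h₁ ⋆ h′)) +⁺ proj₁ (k (s , h₂))
          ≤⟨ +⁺-monoˡ (proj₁ (k (s , h₂))) (-⊖-upper f g s h₁ h′ dis₁) ⟩
        proj₁ ((f -⊖ g) (s , h₁)) +⁺ proj₁ (f (s , h′)) +⁺ proj₁ (k (s , h₂))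
          ≈⟨ xy∙z≈xz∙y (proj₁ ((f -⊖ g) (s , h₁))) (proj₁ (f (s , h′))) (proj₁ (k (s , h₂))) ⟩
        proj₁ ((f -⊖ g) (s , h₁)) +⁺ proj₁ (k (s , h₂)) +⁺ proj₁ (f (s , h′)) ∎)

  -- The side condition on modified variables does its work here: the update of `x` leaves the
  -- frame's cost unchanged.
  subst-frame : ∀ {n} (x : Var n) (e : Expr n) (f g : 𝕋 n) → x ∉Vars g →
    ((f ⊕ g) [ x / e ]) ⊑ ((f [ x / e ]) ⊕ g)
  subst-frame x e f g x∉g = ⊕-greatest (f [ x / e ]) g ((f ⊕ g) [ x / e ]) λ s h₁ h₂ dis →
    P.trans (⊕-lower f g (s [ x ]≔ e s) h₁ h₂ dis)
      (+⁺-monoʳ (proj₁ (f (s [ x ]≔ e s , h₁))) (P.reflexive (x∉g s h₂ (e s))))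

  -- Atomic statements

  module _ {n : ℕ} where

    ert-mono : ∀ (A : Atomic n) (f g : 𝕋 n) → f ⊑ g → ert A f ⊑ ert A g
    ert-mono (x ≔ e)      f g p (s , h) = p (s [ x ]≔ e s , h)
    ert-mono (x ≔alloc e) f g p (s , h) = ⨆-least
      (λ v → (cells v -⊖ f [ x / (λ _ → v) ]) (s , h)) (ert (x ≔alloc e) g (s , h))
      λ v → P.trans
        (-⊖-monoʳ (cells v) (f [ x / (λ _ → v) ]) (g [ x / (λ _ → v) ])
          (λ (s′ , h′) → p (s′ [ x ]≔ v , h′)) (s , h))
        (⨆-upper (λ v → (cells v -⊖ g [ x / (λ _ → v) ]) (s , h)) v)
      where
      cells : ℕ → 𝕋 n
      cells v = ⨁ (e s) (λ i → [ (λ _ → v ℕ.+ i ∸ 1) ↦ (λ _ → 0) ])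
    ert-mono (⟨ e ⟩≔ e′)  f g p = ⊕-mono [ e ↦-] [ e ↦-] ([ e ↦ e′ ] -⊖ f) ([ e ↦ e′ ] -⊖ g)
      (⊑-refl [ e ↦-]) (-⊖-monoʳ [ e ↦ e′ ] f g p)
    ert-mono (x ≔⟨ e ⟩)   f g p (s , h) = ⨅-greatest
      (λ v → (c v ⊕ (c v -⊖ g [ x / (λ _ → v) ])) (s , h)) (ert (x ≔⟨ e ⟩) f (s , h))
      λ v → P.trans
        (⨅-lower (λ v → (c v ⊕ (c v -⊖ f [ x / (λ _ → v) ])) (s , h)) v)
        (⊕-mono (c v) (c v) (c v -⊖ f [ x / (λ _ → v) ]) (c v -⊖ g [ x / (λ _ → v) ])
          (⊑-refl (c v))
          (-⊖-monoʳ (c v) (f [ x / (λ _ → v) ]) (g [ x / (λ _ → v) ])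
            (λ (s′ , h′) → p (s′ [ x ]≔ v , h′)))
          (s , h))
      where
      c : ℕ → 𝕋 n
      c v = [ e ↦ (λ _ → v) ]
    ert-mono (free e)     f g p = ⊕-mono [ e ↦-] [ e ↦-] f g
      (⊑-refl [ e ↦-]) p

    -- The frame is moved outwards one operator at a time: through substitution, then through
    -- `_-⊖_`, then through `_⊕_`.
    ert-frame : ∀ (A : Atomic n) (f g : 𝕋 n) → (∀ x → x ∈ modₐ A → x ∉Vars g) →
      ert A (f ⊕ g) ⊑ ert A f ⊕ g
    ert-frame (x ≔ e)      f g fr = subst-frame x e f g (fr x (x∈⁅x⁆ x))
    ert-frame (x ≔alloc e) f g fr =
      ⊕-greatest (ert (x ≔alloc e) f) g (ert (x ≔alloc e) (f ⊕ g)) λ s h₁ h₂ dis →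
      let cells : ℕ → 𝕋 n
          cells v = ⨁ (e s) (λ i → [ (λ _ → v ℕ.+ i ∸ 1) ↦ (λ _ → 0) ])
          f[_] : ℕ → 𝕋 n
          f[ v ] = f [ x / (λ _ → v) ]
          fg[_] : ℕ → 𝕋 n
          fg[ v ] = (f ⊕ g) [ x / (λ _ → v) ]
      -- The supremum is on the smaller side, so each address `v` is bounded separately and then
      -- absorbed into the supremum for `f`.
      in ⨆-least (λ v → (cells v -⊖ fg[ v ]) (s , h₁ ⋆ h₂))
           (ert (x ≔alloc e) f (s , h₁) +∞ g (s , h₂)) λ v → begin
        proj₁ ((cells v -⊖ fg[ v ]) (s , h₁ ⋆ h₂))
          ≤⟨ -⊖-monoʳ (cells v) fg[ v ] (f[ v ] ⊕ g)
               (subst-frame x (λ _ → v) f g (fr x (x∈⁅x⁆ x))) (s , h₁ ⋆ h₂) ⟩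
        proj₁ ((cells v -⊖ (f[ v ] ⊕ g)) (s , h₁ ⋆ h₂))
          ≤⟨ -⊖-frame (cells v) f[ v ] g (s , h₁ ⋆ h₂) ⟩
        proj₁ (((cells v -⊖ f[ v ]) ⊕ g) (s , h₁ ⋆ h₂))
          ≤⟨ ⊕-lower (cells v -⊖ f[ v ]) g s h₁ h₂ dis ⟩
        proj₁ ((cells v -⊖ f[ v ]) (s , h₁)) +⁺ proj₁ (g (s , h₂))
          ≤⟨ +⁺-monoˡ (proj₁ (g (s , h₂))) (⨆-upper (λ v → (cells v -⊖ f[ v ]) (s , h₁)) v) ⟩
        proj₁ (ert (x ≔alloc e) f (s , h₁)) +⁺ proj₁ (g (s , h₂)) ∎
    ert-frame (⟨ e ⟩≔ e′)  f g fr σ = begin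
      proj₁ (([ e ↦-] ⊕ ([ e ↦ e′ ] -⊖ (f ⊕ g))) σ)
        ≤⟨ ⊕-mono [ e ↦-] [ e ↦-] ([ e ↦ e′ ] -⊖ (f ⊕ g)) (([ e ↦ e′ ] -⊖ f) ⊕ g)
             (⊑-refl [ e ↦-]) (-⊖-frame [ e ↦ e′ ] f g) σ ⟩
      proj₁ (([ e ↦-] ⊕ (([ e ↦ e′ ] -⊖ f) ⊕ g)) σ)
        ≤⟨ ⊕-assoc-⊑ [ e ↦-] ([ e ↦ e′ ] -⊖ f) g σ ⟩
      proj₁ ((([ e ↦-] ⊕ ([ e ↦ e′ ] -⊖ f)) ⊕ g) σ) ∎
    ert-frame (x ≔⟨ e ⟩)   f g fr =
      ⊕-greatest (ert (x ≔⟨ e ⟩) f) g (ert (x ≔⟨ e ⟩) (f ⊕ g)) λ s h₁ h₂ dis →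
      let c : ℕ → 𝕋 n
          c v = [ e ↦ (λ _ → v) ]
          f[_] : ℕ → 𝕋 n
          f[ v ] = f [ x / (λ _ → v) ]
          fg[_] : ℕ → 𝕋 n
          fg[ v ] = (f ⊕ g) [ x / (λ _ → v) ]
      -- Now the infimum is on the larger side, below the cost of the frame. Once `v` is fixed
      -- there, the same `v` is chosen on the left.
      in ⨅-+-greatest (λ v → (c v ⊕ (c v -⊖ f[ v ])) (s , h₁)) (g (s , h₂))
           (ert (x ≔⟨ e ⟩) (f ⊕ g) (s , h₁ ⋆ h₂)) λ v → begin
        proj₁ (ert (x ≔⟨ e ⟩) (f ⊕ g) (s , h₁ ⋆ h₂))
          ≤⟨ ⨅-lower (λ v → (c v ⊕ (c v -⊖ fg[ v ])) (s , h₁ ⋆ h₂)) v ⟩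
        proj₁ ((c v ⊕ (c v -⊖ fg[ v ])) (s , h₁ ⋆ h₂))
          ≤⟨ ⊕-mono (c v) (c v) (c v -⊖ fg[ v ]) (c v -⊖ (f[ v ] ⊕ g)) (⊑-refl (c v))
               (-⊖-monoʳ (c v) fg[ v ] (f[ v ] ⊕ g)
                 (subst-frame x (λ _ → v) f g (fr x (x∈⁅x⁆ x)))) (s , h₁ ⋆ h₂) ⟩
        proj₁ ((c v ⊕ (c v -⊖ (f[ v ] ⊕ g))) (s , h₁ ⋆ h₂))
          ≤⟨ ⊕-mono (c v) (c v) (c v -⊖ (f[ v ] ⊕ g)) ((c v -⊖ f[ v ]) ⊕ g) (⊑-refl (c v))
               (-⊖-frame (c v) f[ v ] g) (s , h₁ ⋆ h₂) ⟩
        proj₁ ((c v ⊕ ((c v -⊖ f[ v ]) ⊕ g)) (s , h₁ ⋆ h₂))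
          ≤⟨ ⊕-assoc-⊑ (c v) (c v -⊖ f[ v ]) g (s , h₁ ⋆ h₂) ⟩
        proj₁ (((c v ⊕ (c v -⊖ f[ v ])) ⊕ g) (s , h₁ ⋆ h₂))
          ≤⟨ ⊕-lower (c v ⊕ (c v -⊖ f[ v ])) g s h₁ h₂ dis ⟩
        proj₁ ((c v ⊕ (c v -⊖ f[ v ])) (s , h₁)) +⁺ proj₁ (g (s , h₂)) ∎
    ert-frame (free e)     f g fr = ⊕-assoc-⊑ [ e ↦-] f g

  -- Amortized runtimes

  if-mono : ∀ b {x y u v} → x ≤⁺ y → u ≤⁺ v → (if b then x else u) ≤⁺ (if b then y else v)
  if-mono true  p q = p
  if-mono false p q = q

  module _ {n : ℕ} (p : PExpr n) where

    open PExpr p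

    0≤weight : ∀ s → 0# ≤ fromℚ (value s)
    0≤weight s = 0≤fromℚ (value≥0 s)

    0≤coweight : ∀ s → 0# ≤ 1# - fromℚ (value s)
    0≤coweight s = x≤y⇒0≤y-x (fromℚ≤1 (value≥0 s) (value≤1 s))

  module _ {n : ℕ} {π : Potential n} where

    ⪯-refl : ∀ (X : 𝔸 π) → X ⪯ X
    ⪯-refl X σ = P.refl {val X σ}

    ⪯-trans : ∀ {X Y Z : 𝔸 π} → X ⪯ Y → Y ⪯ Z → X ⪯ Z
    ⪯-trans p q σ = P.trans (p σ) (q σ)

    ⪯-antisym : ∀ {X Y : 𝔸 π} → X ⪯ Y → Y ⪯ X → X ≗ Y
    ⪯-antisym p q σ = P.antisym (p σ) (q σ)

    ≗⇒⪯ : ∀ {X Y : 𝔸 π} → X ≗ Y → X ⪯ Y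
    ≗⇒⪯ p σ = P.reflexive (p σ)

    +π-mono : ∀ {X Y : 𝔸 π} → X ⪯ Y → X +π ⊑ Y +π
    +π-mono p σ = +⁺-monoˡ [ pot π σ ] (p σ)

    -π-mono : ∀ {f g : 𝕋 n} → f ⊑ g → _⪯_ {π = π} (f -π) (g -π)
    -π-mono p σ = +⁺-monoˡ [ - pot π σ ] (p σ)

    Monotone : (𝔸 π → 𝔸 π) → Set
    Monotone F = ∀ X Y → X ⪯ Y → F X ⪯ F Y

    -- Least fixed points of monotone operators

    module KnasterTarski (F : 𝔸 π → 𝔸 π) (F-mono : Monotone F) where

      Prefixed : Set
      Prefixed = ∃ λ Y → F Y ⪯ Y

      -- Infima are available in `[0,∞]` only, so the prefixed points are first shifted up by the
      -- potential; `μ` shifts the result back.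
      meet : 𝕋 n
      meet σ = ⨅ {Prefixed} λ (Y , _) → (Y +π) σ

      μ : 𝔸 π
      μ = meet -π

      μ-lower : ∀ Y → F Y ⪯ Y → μ ⪯ Y
      μ-lower Y FY⪯Y σ = P.trans
        (+⁺-monoˡ [ - pot π σ ] (⨅-lower {Prefixed} (λ (Y , _) → (Y +π) σ) (Y , FY⪯Y)))
        (P.reflexive (+p-p (val Y σ) (pot π σ)))

      μ-prefixed : F μ ⪯ μ
      μ-prefixed σ = x+p≤y⇒x≤y-p (pot π σ)
        (⨅-greatest {Prefixed} (λ (Y , _) → (Y +π) σ) ((F μ +π) σ) λ (Y , FY⪯Y) →
          +⁺-monoˡ [ pot π σ ] (P.trans (F-mono μ Y (μ-lower Y FY⪯Y) σ) (FY⪯Y σ)))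

      μ-postfixed : μ ⪯ F μ
      μ-postfixed = μ-lower (F μ) (F-mono (F μ) μ μ-prefixed)

      μ-isLeastFixpoint : IsLeastFixpoint F μ
      μ-isLeastFixpoint =
        ⪯-antisym {F μ} {μ} μ-prefixed μ-postfixed ,
        λ Z FZ≗Z → μ-lower Z (≗⇒⪯ {F Z} {Z} FZ≗Z)

      -- The existence of `μ` excludes the default value in the definition of `lfp`.
      lfp-isLeastFixpoint : IsLeastFixpoint F (lfp F)
      lfp-isLeastFixpoint with em {P = ∃ (IsLeastFixpoint F)}
      ... | yes (Y , least) = least
      ... | no none         = contradiction (μ , μ-isLeastFixpoint) none

      lfp-fixed : F (lfp F) ≗ lfp F
      lfp-fixed = proj₁ lfp-isLeastFixpoint

      -- `IsLeastFixpoint` compares with fixed points only. The detour through `μ` extends the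
      -- comparison to prefixed points, which is the induction principle used for loops.
      lfp-least : ∀ Z → F Z ⪯ Z → lfp F ⪯ Z
      lfp-least Z FZ⪯Z = ⪯-trans {lfp F} {μ} {Z}
        (proj₂ lfp-isLeastFixpoint μ (proj₁ μ-isLeastFixpoint)) (μ-lower Z FZ⪯Z)

    ⊞-mono : ∀ e → Monotone (e ⊞_)
    ⊞-mono e X Y p (s , h) = +⁺-monoʳ [ fromℕ (e s) ] (p (s , h))

    cond-mono : ∀ φ (X X′ Y Y′ : 𝔸 π) → X ⪯ X′ → Y ⪯ Y′ → cond φ X Y ⪯ cond φ X′ Y′
    cond-mono φ X X′ Y Y′ p q σ = if-mono (φ (proj₁ σ)) (p σ) (q σ)

    choice-mono : ∀ p (X X′ Y Y′ : 𝔸 π) → X ⪯ X′ → Y ⪯ Y′ → choice p X Y ⪯ choice p X′ Y′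
    choice-mono p X X′ Y Y′ q r σ@(s , _) =
      +⁺-mono-≤⁺ (·-mono (0≤weight p s) (q σ)) (·-mono (0≤coweight p s) (r σ))

    -- Framing

    infixl 5 _⊛_
    _⊛_ : 𝔸 π → 𝕋 n → 𝔸 π
    X ⊛ g = ((X +π) ⊕ g) -π

    module _ (g : 𝕋 n) where

      -- The universal property of `_⊛_`, with subtraction of the potential turned into addition.
      -- The potential is taken at the whole heap on the left and at `h₁` on the right.
      ⊛-lower : ∀ (X : 𝔸 π) s h₁ h₂ → h₁ ⊥ h₂ →
        val (X ⊛ g) (s , h₁ ⋆ h₂) +⁺ [ pot π (s , h₁ ⋆ h₂) ] ≤⁺
        val X (s , h₁) +⁺ [ pot π (s , h₁) ] +⁺ proj₁ (g (s , h₂))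
      ⊛-lower X s h₁ h₂ dis =
        x≤y-p⇒x+p≤y (pot π (s , h₁ ⋆ h₂)) (+⁺-monoˡ [ - pot π (s , h₁ ⋆ h₂) ]
          (⊕-lower (X +π) g s h₁ h₂ dis))

      ⊛-greatest : ∀ (X Y : 𝔸 π) →
        (∀ s h₁ h₂ → h₁ ⊥ h₂ → val Y (s , h₁ ⋆ h₂) +⁺ [ pot π (s , h₁ ⋆ h₂) ] ≤⁺
          val X (s , h₁) +⁺ [ pot π (s , h₁) ] +⁺ proj₁ (g (s , h₂))) →
        Y ⪯ X ⊛ g
      ⊛-greatest X Y p σ = x+p≤y⇒x≤y-p (pot π σ) (⊕-greatest (X +π) g (Y +π) p σ)

      ⊛-mono : ∀ (X Y : 𝔸 π) → X ⪯ Y → X ⊛ g ⪯ Y ⊛ g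
      ⊛-mono X Y p = -π-mono {(X +π) ⊕ g} {(Y +π) ⊕ g}
        (⊕-mono (X +π) (Y +π) g g (+π-mono {X} {Y} p) (⊑-refl g))

      ⊞-frame : ∀ e (X : 𝔸 π) → e ⊞ (X ⊛ g) ⪯ (e ⊞ X) ⊛ g
      ⊞-frame e X = ⊛-greatest (e ⊞ X) (e ⊞ (X ⊛ g)) λ s h₁ h₂ dis →
        let t  = [ fromℕ (e s) ]
            x  = val X (s , h₁)
            y  = val (X ⊛ g) (s , h₁ ⋆ h₂)
            p₁ = [ pot π (s , h₁) ]
            p  = [ pot π (s , h₁ ⋆ h₂) ]
            z  = proj₁ (g (s , h₂))
        in begin
          t +⁺ y +⁺ p          ≈⟨ +⁺-assoc t y p ⟩
          t +⁺ (y +⁺ p)        ≤⟨ +⁺-monoʳ t (⊛-lower X s h₁ h₂ dis) ⟩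
          t +⁺ (x +⁺ p₁ +⁺ z)  ≈⟨ +⁺-assoc t (x +⁺ p₁) z ⟨
          t +⁺ (x +⁺ p₁) +⁺ z  ≈⟨ +⁺-cong (+⁺-assoc t x p₁) (P.Eq.refl {z}) ⟨
          t +⁺ x +⁺ p₁ +⁺ z    ∎

      cond-frame : ∀ φ (X Y : 𝔸 π) → cond φ (X ⊛ g) (Y ⊛ g) ⪯ cond φ X Y ⊛ g
      cond-frame φ X Y = ⊛-greatest (cond φ X Y) (cond φ (X ⊛ g) (Y ⊛ g)) go
        where
        go : ∀ s h₁ h₂ → h₁ ⊥ h₂ →
          val (cond φ (X ⊛ g) (Y ⊛ g)) (s , h₁ ⋆ h₂) +⁺ [ pot π (s , h₁ ⋆ h₂) ] ≤⁺
          val (cond φ X Y) (s , h₁) +⁺ [ pot π (s , h₁) ] +⁺ proj₁ (g (s , h₂))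
        -- The guard reads only the stack, which all parts of a split heap share, so both sides take
        -- the same branch.
        go s h₁ h₂ dis with φ s
        ... | true  = ⊛-lower X s h₁ h₂ dis
        ... | false = ⊛-lower Y s h₁ h₂ dis

      choice-frame : ∀ p (X Y : 𝔸 π) → choice p (X ⊛ g) (Y ⊛ g) ⪯ choice p X Y ⊛ g
      choice-frame p X Y =
        ⊛-greatest (choice p X Y) (choice p (X ⊛ g) (Y ⊛ g)) λ s h₁ h₂ dis →
          -- The cost of the frame is generalised to `z` so that it can be matched on: if infinite
          -- the bound is trivial, and if finite `mix-shift` applies.
          mixed s h₁ h₂ (proj₁ (g (s , h₂))) (⊛-lower X s h₁ h₂ dis) (⊛-lower Y s h₁ h₂ dis)
        where
        mixed : ∀ s h₁ h₂ z →
          let σ₁ = s , h₁ ; σ = s , h₁ ⋆ h₂ in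
          val (X ⊛ g) σ +⁺ [ pot π σ ] ≤⁺ val X σ₁ +⁺ [ pot π σ₁ ] +⁺ z →
          val (Y ⊛ g) σ +⁺ [ pot π σ ] ≤⁺ val Y σ₁ +⁺ [ pot π σ₁ ] +⁺ z →
          val (choice p (X ⊛ g) (Y ⊛ g)) σ +⁺ [ pot π σ ] ≤⁺
          val (choice p X Y) σ₁ +⁺ [ pot π σ₁ ] +⁺ z
        mixed s h₁ h₂ ⊤⁺    q r = x≤y+⊤ (val (choice p X Y) (s , h₁) +⁺ [ pot π (s , h₁) ])
        mixed s h₁ h₂ [ z ] q r = begin
          w · x′ +⁺ w̄ · y′ +⁺ [ c′ ]
            -- The potential is distributed over the two branches to meet the hypotheses; afterwards
            -- the frame's cost and the potential at `h₁` are collected again.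
            ≈⟨ mix-shift w x′ y′ c′ ⟨
          w · (x′ +⁺ [ c′ ]) +⁺ w̄ · (y′ +⁺ [ c′ ])
            ≤⟨ +⁺-mono-≤⁺ (·-mono (0≤weight p s) q) (·-mono (0≤coweight p s) r) ⟩
          w · (x +⁺ [ c ] +⁺ [ z ]) +⁺ w̄ · (y +⁺ [ c ] +⁺ [ z ])
            ≈⟨ mix-shift w (x +⁺ [ c ]) (y +⁺ [ c ]) z ⟩
          w · (x +⁺ [ c ]) +⁺ w̄ · (y +⁺ [ c ]) +⁺ [ z ]
            ≈⟨ +⁺-cong (mix-shift w x y c) (P.Eq.refl {[ z ]}) ⟩
          w · x +⁺ w̄ · y +⁺ [ c ] +⁺ [ z ] ∎
          where
          w w̄ c c′ : ℝ
          w  = fromℚ (PExpr.value p s)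
          w̄  = 1# - w
          c  = pot π (s , h₁)
          c′ = pot π (s , h₁ ⋆ h₂)
          x y x′ y′ : ℝ ⁺
          x  = val X (s , h₁)
          y  = val Y (s , h₁)
          x′ = val (X ⊛ g) (s , h₁ ⋆ h₂)
          y′ = val (Y ⊛ g) (s , h₁ ⋆ h₂)

    -- The potential subtracted by `_⊛_` cancels against the one added before `ert`. Then
    -- `ert-frame` applies, and the potential is inserted again around the framed result.
    aert-atomic-frame : ∀ A (X : 𝔸 π) (g : 𝕋 n) → (∀ x → x ∈ modₐ A → x ∉Vars g) →
      aert π (atomic A) (X ⊛ g) ⪯ aert π (atomic A) X ⊛ g
    aert-atomic-frame A X g fr = -π-mono
      {f = ert A ((X ⊛ g) +π)} {(Y +π) ⊕ g} λ σ → begin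
      proj₁ (ert A ((X ⊛ g) +π) σ)
        ≤⟨ ert-mono A ((X ⊛ g) +π) ((X +π) ⊕ g)
             (λ σ → P.reflexive (-p+p (proj₁ (((X +π) ⊕ g) σ)) (pot π σ))) σ ⟩
      proj₁ (ert A ((X +π) ⊕ g) σ)
        ≤⟨ ert-frame A (X +π) g fr σ ⟩
      proj₁ ((ert A (X +π) ⊕ g) σ)
        ≤⟨ ⊕-mono (ert A (X +π)) (Y +π) g g
             (λ σ → P.reflexive (P.Eq.sym (-p+p (proj₁ (ert A (X +π) σ)) (pot π σ))))
             (⊑-refl g) σ ⟩
      proj₁ (((Y +π) ⊕ g) σ) ∎
      where
      Y = aert π (atomic A) X

  -- Monotonicity and framing by induction on programs

  module _ {n : ℕ} (π : Potential n) where

    loop : BExpr n → Prog n → 𝔸 π → 𝔸 π → 𝔸 π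
    loop φ C X Y = cond φ (aert π C Y) X

    mutual
      aert-mono : ∀ C → Monotone (aert π C)
      aert-mono (tick e)         X Y p = ⊞-mono e X Y p
      aert-mono (atomic A)       X Y p = -π-mono {π = π} {ert A (X +π)} {ert A (Y +π)}
        (ert-mono A (X +π) (Y +π) (+π-mono {X = X} {Y = Y} p))
      aert-mono (C₁ ⟦ q ⟧ C₂)    X Y p = choice-mono q
        (aert π C₁ X) (aert π C₁ Y) (aert π C₂ X) (aert π C₂ Y)
        (aert-mono C₁ X Y p) (aert-mono C₂ X Y p)
      aert-mono (If φ then C₁ else C₂ end) X Y p = cond-mono φ
        (aert π C₁ X) (aert π C₁ Y) (aert π C₂ X) (aert π C₂ Y)
        (aert-mono C₁ X Y p) (aert-mono C₂ X Y p)
      aert-mono (C₁ ⨾ C₂)        X Y p =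
        aert-mono C₁ (aert π C₂ X) (aert π C₂ Y) (aert-mono C₂ X Y p)
      aert-mono (while φ C)      X Y p =
        -- The fixed point `L` for the larger continuation `Y` is a prefixed point of the loop
        -- operator for `X`.
        KnasterTarski.lfp-least (loop φ C X) (loop-mono φ C X) L
          (⪯-trans {X = loop φ C X L} {loop φ C Y L} {L}
            (cond-mono φ (aert π C L) (aert π C L) X Y (⪯-refl (aert π C L)) p)
            (≗⇒⪯ {X = loop φ C Y L} {L}
              (KnasterTarski.lfp-fixed (loop φ C Y) (loop-mono φ C Y))))
        where
        L = aert π (while φ C) Y

      -- Mutual with `aert-mono`: the fixed point of a loop can be reasoned about only once its body
      -- is known to be monotone.
      loop-mono : ∀ φ C X → Monotone (loop φ C X)
      loop-mono φ C X Y Z p =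
        cond-mono φ (aert π C Y) (aert π C Z) X X (aert-mono C Y Z p) (⪯-refl X)

    -- An arbitrary `X` lets the induction hypothesis be used at intermediate results: at
    -- `aert π C₂ X` for sequencing, and at the fixed point `L` for loops.
    aert-frame : ∀ C (X : 𝔸 π) (g : 𝕋 n) → (∀ x → x ∈ mod C → x ∉Vars g) →
      aert π C (X ⊛ g) ⪯ aert π C X ⊛ g
    aert-frame (tick e)         X g fr = ⊞-frame g e X
    aert-frame (atomic A)       X g fr = aert-atomic-frame A X g fr
    aert-frame (C₁ ⟦ p ⟧ C₂)    X g fr =
      ⪯-trans {X = aert π (C₁ ⟦ p ⟧ C₂) (X ⊛ g)}
        {choice p (aert π C₁ X ⊛ g) (aert π C₂ X ⊛ g)} {aert π (C₁ ⟦ p ⟧ C₂) X ⊛ g}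
        (choice-mono p (aert π C₁ (X ⊛ g)) (aert π C₁ X ⊛ g) (aert π C₂ (X ⊛ g)) (aert π C₂ X ⊛ g)
          (aert-frame C₁ X g λ x x∈ → fr x (p⊆p∪q (mod C₂) x∈))
          (aert-frame C₂ X g λ x x∈ → fr x (q⊆p∪q (mod C₁) (mod C₂) x∈)))
        (choice-frame g p (aert π C₁ X) (aert π C₂ X))
    aert-frame (If φ then C₁ else C₂ end) X g fr =
      ⪯-trans {X = aert π (If φ then C₁ else C₂ end) (X ⊛ g)}
        {cond φ (aert π C₁ X ⊛ g) (aert π C₂ X ⊛ g)} {aert π (If φ then C₁ else C₂ end) X ⊛ g}
        (cond-mono φ (aert π C₁ (X ⊛ g)) (aert π C₁ X ⊛ g) (aert π C₂ (X ⊛ g)) (aert π C₂ X ⊛ g)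
          (aert-frame C₁ X g λ x x∈ → fr x (p⊆p∪q (mod C₂) x∈))
          (aert-frame C₂ X g λ x x∈ → fr x (q⊆p∪q (mod C₁) (mod C₂) x∈)))
        (cond-frame g φ (aert π C₁ X) (aert π C₂ X))
    aert-frame (C₁ ⨾ C₂)        X g fr =
      ⪯-trans {X = aert π (C₁ ⨾ C₂) (X ⊛ g)}
        {aert π C₁ (aert π C₂ X ⊛ g)} {aert π (C₁ ⨾ C₂) X ⊛ g}
        (aert-mono C₁ (aert π C₂ (X ⊛ g)) (aert π C₂ X ⊛ g)
          (aert-frame C₂ X g λ x x∈ → fr x (q⊆p∪q (mod C₁) (mod C₂) x∈)))
        (aert-frame C₁ (aert π C₂ X) g λ x x∈ → fr x (p⊆p∪q (mod C₂) x∈))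
    aert-frame (while φ C)      X g fr =
      -- Prefixedness of `L ⊛ g`: frame the body at `L`, pull the frame out of the conditional, and
      -- unfold `L` beneath the frame.
      KnasterTarski.lfp-least (loop φ C (X ⊛ g)) (loop-mono φ C (X ⊛ g)) (L ⊛ g)
        (⪯-trans {X = loop φ C (X ⊛ g) (L ⊛ g)} {loop φ C X L ⊛ g} {L ⊛ g}
          (⪯-trans {X = loop φ C (X ⊛ g) (L ⊛ g)}
            {cond φ (aert π C L ⊛ g) (X ⊛ g)} {loop φ C X L ⊛ g}
            (cond-mono φ (aert π C (L ⊛ g)) (aert π C L ⊛ g) (X ⊛ g) (X ⊛ g)
              (aert-frame C L g fr) (⪯-refl (X ⊛ g)))
            (cond-frame g φ (aert π C L) X))
          (⊛-mono g (loop φ C X L) L (≗⇒⪯ {X = loop φ C X L} {L}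
            (KnasterTarski.lfp-fixed (loop φ C X) (loop-mono φ C X)))))
      where
      L = aert π (while φ C) X

    aert-frame-𝕋 : ∀ C (f g : 𝕋 n) → (∀ x → x ∈ mod C → x ∉Vars g) →
      aert π C ((f ⊕ g) -π) ⪯ (((aert π C (f -π) +π) ⊕ g) -π)
    aert-frame-𝕋 C f g fr =
      ⪯-trans {X = aert π C ((f ⊕ g) -π)} {aert π C (X ⊛ g)} {aert π C X ⊛ g}
        -- Subtracting and adding the potential restores `f`, so `(f ⊕ g) -π` lies below `X ⊛ g`.
        (aert-mono C ((f ⊕ g) -π) (X ⊛ g)
          (-π-mono {π = π} {f ⊕ g} {(X +π) ⊕ g}
            (⊕-mono f (X +π) g g
              (λ σ → P.reflexive (P.Eq.sym (-p+p (proj₁ (f σ)) (pot π σ)))) (⊑-refl g))))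
        (aert-frame C X g fr)
      where
      X : 𝔸 π
      X = f -π

mainTheorem5 : (em : ExcludedMiddle 0ℓ) (ℝ-field : CompleteOrderedField) →
    let open Semantics em ℝ-field in
    ∀ {n : ℕ} (π : Potential n) (C : Prog n) (f g : 𝕋 n) →
    (∀ x → x ∈ mod C → x ∉Vars g) →
    aert π C ((f ⊕ g) -π) ⪯ (((aert π C (f -π) +π) ⊕ g) -π)
mainTheorem5 em ℝ-field = Framing.aert-frame-𝕋 em ℝ-field
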